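{- For every $n$, every linear 3-uniform hypergraph on $n$ vertices that contains neither $\mathcal{W}^3$ nor $F_7$ as an induced subgraph has at most $\frac{n^2}{9}$ edges; that is, $\mathrm{ex}_{\mathrm{lin,ind}}(n,\{\mathcal{W}^3,F_7\})\le \frac{n^2}{9}$. Moreover, equality holds for infinitely many $n$.
   Context: A 3-uniform hypergraph is linear if any two distinct edges share at most one vertex. $\mathrm{ex}_{\mathrm{lin,ind}}(n,\mathcal{G})$ is the maximum number of edges of an $n$-vertex linear 3-uniform hypergraph containing no member of $\mathcal{G}$ as an induced subgraph (a vertex subset whose induced subhypergraph is isomorphic to that member). Here $\mathcal{W}^3$ denotes the hypergraph on vertices $\{1,\dots,6\}$ with edges $\{1,2,3\},\{3,4,5\},\{5,6,1\}$ (a linear 3-cycle), and $F_7$ denotes the Fano plane: the hypergraph on the 7 nonzero vectors of $\mathbb{F}_2^3$ whose edges are the triples $\{x,y,z\}$ of distinct vectors with $x+y+z=0$. -}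

module Defs where

open import Data.Bool using (Bool; true; false; _xor_)
import Data.Bool.Properties as Bool
open import Data.Fin using (Fin; zero; suc; #_)
open import Data.Fin.Subset using (Subset; inside; outside; ⊥; ⁅_⁆; _∪_; _∩_; ∣_∣; _∈_)
open import Data.Fin.Subset.Properties using (_⊆?_)
open import Data.List using (List; []; _∷_; _++_; map; filter; length)
import Data.List.Membership.Propositional as List
open import Data.List.Relation.Unary.All using (All)
open import Data.List.Relation.Unary.AllPairs using (allPairs?)
open import Data.List.Relation.Unary.Unique.Propositional using (Unique)
open import Data.Nat using (ℕ; zero; suc; _≤_)
import Data.Nat.Properties as ℕ
open import Data.Product using (Σ; ∃; ∃-syntax; _×_; _,_; proj₁; proj₂)
open import Data.Vec using (Vec; []; _∷_; replicate; zipWith)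
import Data.Vec.Properties as Vec
open import Function using (_∘_; _⇔_; _↔_; Inverse)
open import Relation.Binary.Definitions using (DecidableEquality)
open import Relation.Binary.PropositionalEquality using (_≡_; _≢_)
open import Relation.Nullary using (¬_; ¬?; _×-dec_)
open import Relation.Nullary.Decidable using (from-yes)
open import Relation.Unary using (Decidable)

_≟ˢ_ : ∀ {n} → DecidableEquality (Subset n)
_≟ˢ_ = Vec.≡-dec Bool._≟_

record Hypergraph (n : ℕ) : Set where
  field
    edges  : List (Subset n)
    unique : Unique edges

open Hypergraph public

#edges : ∀ {n} → Hypergraph n → ℕ
#edges H = length (edges H)

Uniform : ℕ → ∀ {n} → Hypergraph n → Set
Uniform r H = ∀ {e} → e List.∈ edges H → ∣ e ∣ ≡ r

Linear : ∀ {n} → Hypergraph n → Set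
Linear H = ∀ {e f} → e List.∈ edges H → f List.∈ edges H → e ≢ f → ∣ e ∩ f ∣ ≤ 1

-- The edges of H lying entirely inside S: the edge set of the hypergraph
-- with vertex set S induced by H.
inducedEdges : ∀ {n} → Hypergraph n → Subset n → List (Subset n)
inducedEdges H S = filter (_⊆? S) (edges H)

image : ∀ {m n} → (Fin m → Fin n) → Subset m → Subset n
image φ []            = ⊥
image φ (inside  ∷ e) = ⁅ φ zero ⁆ ∪ image (φ ∘ suc) e
image φ (outside ∷ e) = image (φ ∘ suc) e

-- A vertex subset S of H together with an isomorphism from G onto the
-- subhypergraph of H induced on S.
record InducedCopy {m n : ℕ} (G : Hypergraph m) (H : Hypergraph n) : Set where
  field
    S    : Subset n
    bij  : Fin m ↔ ∃ (_∈ S)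
    edge : ∀ e → (e List.∈ edges G) ⇔
                 (image (proj₁ ∘ Inverse.to bij) e List.∈ inducedEdges H S)

Family : Set
Family = List (Σ ℕ Hypergraph)

InducedFree : Family → ∀ {n} → Hypergraph n → Set
InducedFree 𝒢 H = All (λ G → ¬ InducedCopy (proj₂ G) H) 𝒢

Admissible : Family → ∀ {n} → Hypergraph n → Set
Admissible 𝒢 H = Uniform 3 H × Linear H × InducedFree 𝒢 H

-- exₗᵢₙ,ᵢₙ𝒹(n, 𝒢) = k, the maximum being given by its defining property:
-- k is attained and is an upper bound.
ExLinInd≡ : ℕ → Family → ℕ → Set
ExLinInd≡ n 𝒢 k =
  (∃[ H ] Admissible 𝒢 {n} H × #edges H ≡ k) ×
  (∀ (H : Hypergraph n) → Admissible 𝒢 H → #edges H ≤ k)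

triple : ∀ {n} → Fin n → Fin n → Fin n → Subset n
triple a b c = ⁅ a ⁆ ∪ ⁅ b ⁆ ∪ ⁅ c ⁆

-- The vertices 1, …, 6 are represented by # 0, …, # 5.
W³ : Hypergraph 6
W³ = record { edges = es ; unique = from-yes (allPairs? (λ e f → ¬? (e ≟ˢ f)) es) }
  where
  es : List (Subset 6)
  es = triple (# 0) (# 1) (# 2)
     ∷ triple (# 2) (# 3) (# 4)
     ∷ triple (# 4) (# 5) (# 0)
     ∷ []

-- true is 1 and false is 0 in 𝔽₂.
𝔽₂³ : Set
𝔽₂³ = Vec Bool 3

𝟎 : 𝔽₂³
𝟎 = replicate 3 false

_⊕_ : 𝔽₂³ → 𝔽₂³ → 𝔽₂³
_⊕_ = zipWith _xor_

nonzeroVectors : Vec 𝔽₂³ 7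
nonzeroVectors =
    (false ∷ false ∷ true  ∷ [])
  ∷ (false ∷ true  ∷ false ∷ [])
  ∷ (false ∷ true  ∷ true  ∷ [])
  ∷ (true  ∷ false ∷ false ∷ [])
  ∷ (true  ∷ false ∷ true  ∷ [])
  ∷ (true  ∷ true  ∷ false ∷ [])
  ∷ (true  ∷ true  ∷ true  ∷ [])
  ∷ []

-- The sum of the vectors whose positions belong to e.
sumOver : ∀ {m} → Subset m → Vec 𝔽₂³ m → 𝔽₂³
sumOver []            []       = 𝟎
sumOver (inside  ∷ e) (v ∷ vs) = v ⊕ sumOver e vs
sumOver (outside ∷ e) (v ∷ vs) = sumOver e vs

IsLine : Subset 7 → Set
IsLine e = ∣ e ∣ ≡ 3 × sumOver e nonzeroVectors ≡ 𝟎

isLine? : Decidable IsLine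
isLine? e = (∣ e ∣ ℕ.≟ 3) ×-dec Vec.≡-dec Bool._≟_ (sumOver e nonzeroVectors) 𝟎

subsets : ∀ n → List (Subset n)
subsets zero    = [] ∷ []
subsets (suc n) = map (inside ∷_) (subsets n) ++ map (outside ∷_) (subsets n)

-- Vertex i of F₇ stands for the vector lookup nonzeroVectors i.
F₇ : Hypergraph 7
F₇ = record { edges = es ; unique = from-yes (allPairs? (λ e f → ¬? (e ≟ˢ f)) es) }
  where
  es : List (Subset 7)
  es = filter isLine? (subsets 7)

𝒲³,F₇ : Family
𝒲³,F₇ = (6 , W³) ∷ (7 , F₇) ∷ []

{-# OPTIONS --safe #-}

-- In an admissible hypergraph every linear 3-cycle closes up to a Pasch
-- configuration, and if a vertex w were joined to all three vertices of an edge
-- avoiding it, the three Pasch configurations obtained would form a Fano plane.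
-- So for an edge e every w ∉ e is joined to at most two vertices of e. Counting
-- the joined pairs gives ∑_{v ∈ e} deg v ≤ n, hence ∑ (deg v)² ≤ n m on summing
-- over the m edges, and Cauchy–Schwarz gives (3m)² ≤ n · n m.
--
-- Equality holds for the transversal design of 𝔽₂ᵏ: the vertices are the pairs
-- (i , u) with i ∈ {0,1,2} and u ∈ 𝔽₂ᵏ, and the edges are
-- {(0,u) , (1,v) , (2,w)} with u + v + w = 0.
module Submission where

open import Defs
open import Data.Bool using (Bool; true; false; if_then_else_; _xor_)
open import Data.Bool.Properties using (xor-comm; xor-assoc; xor-same)
open import Data.Fin using (Fin; zero; suc; #_; combine; remQuot)
import Data.Fin.Properties as Fin
open import Data.Fin.Subset
  using (Subset; inside; outside; ⊥; ⊤; ⁅_⁆; _∪_; _∩_; ∣_∣; _∈_; _∉_; _⊆_)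
open import Data.Fin.Subset.Properties
open import Data.List as List using (List; []; _∷_; length; map; allFin; cartesianProduct)
import Data.List.Membership.DecPropositional as DecMembership
import Data.List.Membership.Propositional as List
open import Data.List.Membership.Propositional.Properties
  using (∈-map⁺; ∈-map⁻; ∈-allFin; ∈-cartesianProduct⁺; ∈-filter⁺; ∈-filter⁻; ∈-lookup)
open import Data.List.Properties using (length-map; length-tabulate; length-++)
open import Data.List.Relation.Unary.All as All using (All; []; _∷_; all?)
open import Data.List.Relation.Unary.AllPairs using ([]; _∷_)
open import Data.List.Relation.Unary.Any using (here; there)
open import Data.List.Relation.Unary.Unique.Propositional using (Unique)
import Data.List.Relation.Unary.Unique.Propositional.Properties as Unique
open import Data.Nat
open import Data.Nat.Properties
open import Data.Nat.Tactic.RingSolver using (solve-∀)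
open import Data.Product using (∃; ∃-syntax; ∃₂; _×_; _,_; proj₁; proj₂; uncurry)
open import Data.Product.Function.NonDependent.Propositional using (_×-↔_)
open import Data.Sum using (_⊎_; inj₁; inj₂; [_,_]′)
open import Data.Vec as Vec using (Vec; []; _∷_; here; there; lookup; zipWith)
open import Data.Vec.Properties using (zipWith-assoc; zipWith-comm)
open import Data.Vec.Properties.WithK using ([]=-irrelevant)
open import Data.Vec.Relation.Unary.All using ([]; _∷_)
open import Data.Vec.Relation.Unary.AllPairs using ([]; _∷_)
import Data.Vec.Relation.Unary.Unique.Propositional as Vec
open import Data.Vec.Relation.Unary.Unique.Propositional.Properties using (lookup-injective)
open import Function using (_∘_; _⇔_; mk⇔; mk↔ₛ′; _↔_; Inverse; Injection; Equivalence)
open import Function.Construct.Composition using (_↔-∘_)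
open import Function.Construct.Symmetry using (↔-sym)
open import Function.Definitions using (Injective)
open import Function.Properties.Inverse using (↔⇒↣)
open import Relation.Binary.PropositionalEquality
open import Relation.Nullary using (¬_; Dec; yes; no; ¬?; _×-dec_; _⊎-dec_; _→-dec_; contradiction)
open import Relation.Nullary.Decidable using (from-yes; from-no; decidable-stable)
open import Relation.Unary using (Decidable)

open import Algebra.Properties.Semiring.Sum +-*-semiring
  using (sum; sum-syntax; sum-cong-≗; ∑-comm; ∑-distrib-+; *-distribˡ-sum; *-distribʳ-sum)

private variable
  m n k : ℕ

-- Finite sums of natural numbers and the Cauchy-Schwarz inequality

sum-mono : {f g : Fin n → ℕ} → (∀ i → f i ≤ g i) → sum f ≤ sum g
sum-mono {zero}  f≤g = z≤n
sum-mono {suc n} f≤g = +-mono-≤ (f≤g zero) (sum-mono (f≤g ∘ suc))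

sum-const : ∀ n c → ∑[ i < n ] c ≡ n * c
sum-const zero    c = refl
sum-const (suc n) c = cong (c +_) (sum-const n c)

sum-zero : {f : Fin n → ℕ} → (∀ i → f i ≡ 0) → sum f ≡ 0
sum-zero {n} f≡0 = trans (sum-cong-≗ f≡0) (trans (sum-const n 0) (*-zeroʳ n))

sum>0⇒∃ : (f : Fin n → ℕ) → 0 < sum f → ∃[ i ] 0 < f i
sum>0⇒∃ {suc n} f 0<Σ with f zero in eq
... | suc _ = zero , subst (0 <_) (sym eq) z<s
... | zero with sum>0⇒∃ (f ∘ suc) 0<Σ
...   | i , 0<fi = suc i , 0<fi

-- Meant for codegrees: each summand says whether one edge contains a given pair of vertices, and
-- linearity leaves at most one such edge.
sum≤1 : (f : Fin n → ℕ) → (∀ i → f i ≤ 1) →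
        (∀ i j → 0 < f i → 0 < f j → i ≡ j) → sum f ≤ 1
sum≤1 {zero}  f f≤1 single = z≤n
sum≤1 {suc n} f f≤1 single with f zero in eq
... | zero  = sum≤1 (f ∘ suc) (f≤1 ∘ suc)
                λ i j p q → Fin.suc-injective (single (suc i) (suc j) p q)
... | suc a = begin
  suc a + sum (f ∘ suc) ≡⟨ cong (suc a +_) (sum-zero tail≡0) ⟩
  suc a + 0             ≡⟨ +-identityʳ _ ⟩
  suc a                 ≡⟨ eq ⟨
  f zero                ≤⟨ f≤1 zero ⟩
  1                     ∎
  where
  open ≤-Reasoning
  tail≡0 : ∀ i → f (suc i) ≡ 0
  tail≡0 i with f (suc i) in eq′
  ... | zero  = refl
  ... | suc b with () ← single zero (suc i) (subst (0 <_) (sym eq) z<s) (subst (0 <_) (sym eq′) z<s)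

product>0 : ∀ {x y} → 0 < x * y → 0 < x × 0 < y
product>0 {suc x} {zero}  lt = contradiction (subst (0 <_) (*-zeroʳ x) lt) λ ()
product>0 {suc x} {suc y} _  = z<s , z<s

-- Subtraction is avoided by writing the larger number as `x + d`; the two sides then differ by
-- `d * d`.
2xy≤x²+y² : ∀ x y → 2 * (x * y) ≤ x * x + y * y
2xy≤x²+y² x y =
  [ ordered , (λ y≤x → subst₂ _≤_ (cong (2 *_) (*-comm y x)) (+-comm (y * y) (x * x)) (ordered y≤x)) ]′
  (≤-total x y)
  where
  square : ∀ x d → 2 * (x * (x + d)) + d * d ≡ x * x + (x + d) * (x + d)
  square = solve-∀
  ordered : ∀ {x y} → x ≤ y → 2 * (x * y) ≤ x * x + y * y
  ordered {x} x≤y with d , refl ← m≤n⇒∃[o]m+o≡n x≤y = begin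
    2 * (x * (x + d))          ≤⟨ m≤m+n _ (d * d) ⟩
    2 * (x * (x + d)) + d * d  ≡⟨ square x d ⟩
    x * x + (x + d) * (x + d)  ∎
    where open ≤-Reasoning

-- After doubling, both sides are sums over pairs `(i , j)`, and the inequality holds pair by pair
-- because the product of two numbers is at most half the sum of their squares.
cauchy-schwarz : (d : Fin n → ℕ) → sum d * sum d ≤ n * ∑[ i < n ] (d i * d i)
cauchy-schwarz {n} d = *-cancelˡ-≤ 2 (begin
  2 * (sum d * sum d)
    ≡⟨ cong (2 *_) (*-distribʳ-sum (sum d) d) ⟩
  2 * ∑[ i < n ] (d i * sum d)
    ≡⟨ *-distribˡ-sum 2 (λ i → d i * sum d) ⟩
  ∑[ i < n ] (2 * (d i * sum d))
    ≤⟨ sum-mono row ⟩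
  ∑[ i < n ] (n * (d i * d i) + Q)
    ≡⟨ ∑-distrib-+ (λ i → n * (d i * d i)) (λ _ → Q) ⟩
  ∑[ i < n ] (n * (d i * d i)) + ∑[ i < n ] Q
    ≡⟨ cong₂ _+_ (sym (*-distribˡ-sum n (λ i → d i * d i))) (sum-const n Q) ⟩
  n * Q + n * Q
    ≡⟨ cong (n * Q +_) (+-identityʳ (n * Q)) ⟨
  2 * (n * Q) ∎)
  where
  open ≤-Reasoning
  Q = ∑[ i < n ] (d i * d i)
  row : ∀ i → 2 * (d i * sum d) ≤ n * (d i * d i) + Q
  row i = begin
    2 * (d i * sum d)                    ≡⟨ *-assoc 2 (d i) (sum d) ⟨
    2 * d i * sum d                      ≡⟨ *-distribˡ-sum (2 * d i) d ⟩
    ∑[ j < n ] (2 * d i * d j)           ≤⟨ sum-mono cell ⟩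
    ∑[ j < n ] (d i * d i + d j * d j)   ≡⟨ ∑-distrib-+ (λ _ → d i * d i) (λ j → d j * d j) ⟩
    ∑[ j < n ] (d i * d i) + Q           ≡⟨ cong (_+ Q) (sum-const n (d i * d i)) ⟩
    n * (d i * d i) + Q                  ∎
    where
    cell : ∀ j → 2 * d i * d j ≤ d i * d i + d j * d j
    cell j = ≤-trans (≤-reflexive (*-assoc 2 (d i) (d j))) (2xy≤x²+y² (d i) (d j))

-- Double counting with an incidence matrix

module Incidence (M : Fin m → Fin n → ℕ) where

  degree : Fin n → ℕ
  degree v = ∑[ i < m ] M i v

  -- The diagonal `v ≡ w` is deliberately included: for a 0/1 matrix it equals the degree. This
  -- makes the row sums exactly three times the degree.
  codegree : Fin n → Fin n → ℕ
  codegree v w = ∑[ i < m ] (M i v * M i w)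

  -- With `f` the degree itself, this turns the degree sums of the edges into the sum of squared
  -- degrees.
  weighted-sum : (f : Fin n → ℕ) →
                 ∑[ i < m ] ∑[ v < n ] (M i v * f v) ≡ ∑[ v < n ] (degree v * f v)
  weighted-sum f = trans (∑-comm (λ i v → M i v * f v))
    (sum-cong-≗ λ v → sym (*-distribʳ-sum (f v) (λ i → M i v)))

  module _ (3-uniform : ∀ i → ∑[ v < n ] M i v ≡ 3) where

    sum-codegree : ∀ v → ∑[ w < n ] codegree v w ≡ degree v * 3
    sum-codegree v = begin
      ∑[ w < n ] ∑[ i < m ] (M i v * M i w)  ≡⟨ ∑-comm (λ w i → M i v * M i w) ⟩
      ∑[ i < m ] ∑[ w < n ] (M i v * M i w)  ≡⟨ sum-cong-≗ (λ i → *-distribˡ-sum (M i v) (M i)) ⟨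
      ∑[ i < m ] (M i v * sum (M i))         ≡⟨ sum-cong-≗ (λ i → cong (M i v *_) (3-uniform i)) ⟩
      ∑[ i < m ] (M i v * 3)                 ≡⟨ *-distribʳ-sum 3 (λ i → M i v) ⟨
      degree v * 3                           ∎
      where open ≡-Reasoning

    -- The hypothesis allows each vertex `w` two joined pairs with edge `i`, and a vertex of the
    -- edge additionally its own diagonal term. Let `S` be the degree sum of the edge. Summing over
    -- `w` gives 3S on the left and 2n + S on the right, since the diagonal terms add up to `S`
    -- again; hence S ≤ n.
    edge-degree-sum : ∀ i → (∀ w → ∑[ v < n ] (M i v * codegree v w) ≤ 2 + M i w * degree w) →
                      ∑[ v < n ] (M i v * degree v) ≤ n
    edge-degree-sum i local = *-cancelʳ-≤ S n 2 (+-cancelʳ-≤ S (S * 2) (n * 2) (begin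
      S * 2 + S
        ≡⟨ three S ⟩
      S * 3
        ≡⟨ *-distribʳ-sum 3 (λ v → M i v * degree v) ⟩
      ∑[ v < n ] (M i v * degree v * 3)
        ≡⟨ sum-cong-≗ (λ v → *-assoc (M i v) (degree v) 3) ⟩
      ∑[ v < n ] (M i v * (degree v * 3))
        ≡⟨ sum-cong-≗ (λ v → cong (M i v *_) (sum-codegree v)) ⟨
      ∑[ v < n ] (M i v * ∑[ w < n ] codegree v w)
        ≡⟨ sum-cong-≗ (λ v → *-distribˡ-sum (M i v) (codegree v)) ⟩
      ∑[ v < n ] ∑[ w < n ] (M i v * codegree v w)
        ≡⟨ ∑-comm (λ v w → M i v * codegree v w) ⟩
      ∑[ w < n ] ∑[ v < n ] (M i v * codegree v w)
        ≤⟨ sum-mono local ⟩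
      ∑[ w < n ] (2 + M i w * degree w)
        ≡⟨ ∑-distrib-+ (λ _ → 2) (λ w → M i w * degree w) ⟩
      ∑[ w < n ] 2 + S
        ≡⟨ cong (_+ S) (sum-const n 2) ⟩
      n * 2 + S ∎))
      where
      open ≤-Reasoning
      S = ∑[ v < n ] (M i v * degree v)
      three : ∀ s → s * 2 + s ≡ s * 3
      three = solve-∀

    sum-degree : sum degree ≡ m * 3
    sum-degree = begin
      ∑[ v < n ] ∑[ i < m ] M i v  ≡⟨ ∑-comm (λ v i → M i v) ⟩
      ∑[ i < m ] sum (M i)         ≡⟨ sum-cong-≗ 3-uniform ⟩
      ∑[ i < m ] 3                 ≡⟨ sum-const m 3 ⟩
      m * 3                        ∎
      where open ≡-Reasoning

    9m²≤n²m : (∀ i → ∑[ v < n ] (M i v * degree v) ≤ n) → 9 * m * m ≤ n ^ 2 * m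
    9m²≤n²m light = begin
      9 * m * m                          ≡⟨ nine m ⟩
      m * 3 * (m * 3)                    ≡⟨ cong₂ _*_ sum-degree sum-degree ⟨
      sum degree * sum degree            ≤⟨ cauchy-schwarz degree ⟩
      n * ∑[ v < n ] (degree v * degree v)
        ≡⟨ cong (n *_) (weighted-sum degree) ⟨
      n * ∑[ i < m ] ∑[ v < n ] (M i v * degree v)
        ≤⟨ *-monoʳ-≤ n (sum-mono light) ⟩
      n * ∑[ i < m ] n                   ≡⟨ cong (n *_) (sum-const m n) ⟩
      n * (m * n)                        ≡⟨ rearrange n m ⟩
      n ^ 2 * m                          ∎
      where
      open ≤-Reasoning
      nine : ∀ m → 9 * m * m ≡ m * 3 * (m * 3)
      nine = solve-∀
      rearrange : ∀ n m → n * (m * n) ≡ n * (n * 1) * m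
      rearrange = solve-∀

    9m≤n² : (∀ i → ∑[ v < n ] (M i v * degree v) ≤ n) → 9 * m ≤ n ^ 2
    9m≤n² light = cancel (9m²≤n²m light)
      where
      -- Division by `m` needs `m` positive. Generalising `m` here splits off the zero case without
      -- disturbing `M`, whose type mentions `m`.
      cancel : ∀ {m} → 9 * m * m ≤ n ^ 2 * m → 9 * m ≤ n ^ 2
      cancel {zero}  _  = z≤n
      cancel {suc k} le = *-cancelʳ-≤ (9 * suc k) (n ^ 2) (suc k) le

-- Finite subsets

χ : Subset n → Fin n → ℕ
χ p v = if lookup p v then 1 else 0

χ≤1 : ∀ (p : Subset n) v → χ p v ≤ 1
χ≤1 p v with lookup p v
... | true  = ≤-refl
... | false = z≤n

∈⇒χ≡1 : ∀ {p : Subset n} {v} → v ∈ p → χ p v ≡ 1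
∈⇒χ≡1 here        = refl
∈⇒χ≡1 (there v∈p) = ∈⇒χ≡1 v∈p

∉⇒χ≡0 : ∀ {p : Subset n} {v} → v ∉ p → χ p v ≡ 0
∉⇒χ≡0 {p = inside  ∷ p} {zero}  v∉p = contradiction here v∉p
∉⇒χ≡0 {p = outside ∷ p} {zero}  v∉p = refl
∉⇒χ≡0 {p = x ∷ p}       {suc v} v∉p = ∉⇒χ≡0 (v∉p ∘ there)

χ>0⇒∈ : ∀ (p : Subset n) {v} → 0 < χ p v → v ∈ p
χ>0⇒∈ (inside ∷ p)  {zero}  _  = here
χ>0⇒∈ (x ∷ p)       {suc v} lt = there (χ>0⇒∈ p lt)

sum-χ : ∀ (p : Subset n) → ∑[ v < n ] χ p v ≡ ∣ p ∣
sum-χ []            = refl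
sum-χ (inside  ∷ p) = cong suc (sum-χ p)
sum-χ (outside ∷ p) = sum-χ p

sum-insert : ∀ {a} {p : Subset n} (f : Fin n → ℕ) → a ∉ p →
             ∑[ v < n ] (χ (⁅ a ⁆ ∪ p) v * f v) ≡ f a + ∑[ v < n ] (χ p v * f v)
sum-insert {a = zero}  {inside  ∷ p} f a∉p = contradiction here a∉p
sum-insert {a = zero}  {outside ∷ p} f a∉p = cong₂ _+_ (*-identityˡ (f zero))
  (sum-cong-≗ λ v → cong (λ q → χ q v * f (suc v)) (∪-identityˡ p))
sum-insert {a = suc a} {x ∷ p} f a∉p = begin
  χ⁰ * f zero + ∑[ v < _ ] (χ (⁅ a ⁆ ∪ p) v * f (suc v))
    ≡⟨ cong (χ⁰ * f zero +_) (sum-insert (f ∘ suc) (a∉p ∘ there)) ⟩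
  χ⁰ * f zero + (f (suc a) + R)  ≡⟨ +-assoc (χ⁰ * f zero) _ _ ⟨
  χ⁰ * f zero + f (suc a) + R    ≡⟨ cong (_+ R) (+-comm _ (f (suc a))) ⟩
  f (suc a) + χ⁰ * f zero + R    ≡⟨ +-assoc (f (suc a)) _ _ ⟩
  f (suc a) + (χ⁰ * f zero + R)  ∎
  where
  open ≡-Reasoning
  χ⁰ = if x then 1 else 0
  R  = ∑[ v < _ ] (χ p v * f (suc v))

∣insert∣ : ∀ {a} {p : Subset n} → a ∉ p → ∣ ⁅ a ⁆ ∪ p ∣ ≡ suc ∣ p ∣
∣insert∣ {a = a} {p} a∉p = begin
  ∣ ⁅ a ⁆ ∪ p ∣                  ≡⟨ ∣∣≡∑ (⁅ a ⁆ ∪ p) ⟩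
  ∑[ v < _ ] (χ (⁅ a ⁆ ∪ p) v * 1) ≡⟨ sum-insert (λ _ → 1) a∉p ⟩
  suc (∑[ v < _ ] (χ p v * 1))     ≡⟨ cong suc (∣∣≡∑ p) ⟨
  suc ∣ p ∣                      ∎
  where
  open ≡-Reasoning
  ∣∣≡∑ : ∀ p → ∣ p ∣ ≡ ∑[ v < _ ] (χ p v * 1)
  ∣∣≡∑ p = trans (sym (sum-χ p)) (sum-cong-≗ λ v → sym (*-identityʳ (χ p v)))

∈⇒insert : ∀ {a} {p : Subset n} → a ∈ p → ∃[ q ] (a ∉ q × p ≡ ⁅ a ⁆ ∪ q)
∈⇒insert (here {xs = p}) = outside ∷ p , (λ ()) , cong (inside ∷_) (sym (∪-identityˡ p))
∈⇒insert (there {y = x} a∈p) with q , a∉q , refl ← ∈⇒insert a∈p =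
  x ∷ q , (λ { (there a∈q) → a∉q a∈q }) , refl

nonempty : ∀ (p : Subset n) → ∣ p ∣ ≡ suc k → ∃[ a ] a ∈ p
nonempty (inside  ∷ p) _  = zero , here
nonempty (outside ∷ p) eq with a , a∈p ← nonempty p eq = suc a , there a∈p

∣p∣≡0⇒p≡⊥ : ∀ (p : Subset n) → ∣ p ∣ ≡ 0 → p ≡ ⊥
∣p∣≡0⇒p≡⊥ []            _  = refl
∣p∣≡0⇒p≡⊥ (outside ∷ p) eq = cong (outside ∷_) (∣p∣≡0⇒p≡⊥ p eq)

remove-size : ∀ {a} {q : Subset n} → a ∉ q → ∣ ⁅ a ⁆ ∪ q ∣ ≡ suc k → ∣ q ∣ ≡ k
remove-size a∉q eq = suc-injective (trans (sym (∣insert∣ a∉q)) eq)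

∈-insert⁻ : ∀ {a b} {p : Subset n} → b ≢ a → b ∈ ⁅ a ⁆ ∪ p → b ∈ p
∈-insert⁻ {a = a} {p = p} b≢a b∈ with x∈p∪q⁻ ⁅ a ⁆ p b∈
... | inj₁ b∈a = contradiction (x∈⁅y⁆⇒x≡y a b∈a) b≢a
... | inj₂ b∈p = b∈p

two-elements : ∀ (p : Subset n) → ∣ p ∣ ≡ suc (suc k) → ∃₂ λ a b → a ≢ b × a ∈ p × b ∈ p
two-elements p eq with a , a∈p ← nonempty p eq
  with q , a∉q , refl ← ∈⇒insert a∈p
  with b , b∈q ← nonempty q (remove-size a∉q eq)
  = a , b , (λ { refl → a∉q b∈q }) , a∈p , x∈p∪q⁺ (inj₂ b∈q)

record Distinct (a b c : Fin n) : Set where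
  constructor distinct
  field
    a≢b : a ≢ b
    b≢c : b ≢ c
    a≢c : a ≢ c

∈-triple⁻ : ∀ {a b c v : Fin n} → v ∈ triple a b c → v ≡ a ⊎ v ≡ b ⊎ v ≡ c
∈-triple⁻ {a = a} {b} {c} v∈ with x∈p∪q⁻ ⁅ a ⁆ (⁅ b ⁆ ∪ ⁅ c ⁆) v∈
... | inj₁ v∈a = inj₁ (x∈⁅y⁆⇒x≡y a v∈a)
... | inj₂ v∈bc with x∈p∪q⁻ ⁅ b ⁆ ⁅ c ⁆ v∈bc
...   | inj₁ v∈b = inj₂ (inj₁ (x∈⁅y⁆⇒x≡y b v∈b))
...   | inj₂ v∈c = inj₂ (inj₂ (x∈⁅y⁆⇒x≡y c v∈c))

fst∈ : ∀ {a b c : Fin n} → a ∈ triple a b c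
fst∈ {a = a} = x∈p∪q⁺ (inj₁ (x∈⁅x⁆ a))

snd∈ : ∀ {a b c : Fin n} → b ∈ triple a b c
snd∈ {b = b} = x∈p∪q⁺ (inj₂ (x∈p∪q⁺ (inj₁ (x∈⁅x⁆ b))))

thd∈ : ∀ {a b c : Fin n} → c ∈ triple a b c
thd∈ {c = c} = x∈p∪q⁺ (inj₂ (x∈p∪q⁺ (inj₂ (x∈⁅x⁆ c))))

triple-swap₁₂ : ∀ (a b c : Fin n) → triple a b c ≡ triple b a c
triple-swap₁₂ a b c = begin
  ⁅ a ⁆ ∪ ⁅ b ⁆ ∪ ⁅ c ⁆   ≡⟨ ∪-assoc ⁅ a ⁆ ⁅ b ⁆ ⁅ c ⁆ ⟨
  (⁅ a ⁆ ∪ ⁅ b ⁆) ∪ ⁅ c ⁆ ≡⟨ cong (_∪ ⁅ c ⁆) (∪-comm ⁅ a ⁆ ⁅ b ⁆) ⟩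
  (⁅ b ⁆ ∪ ⁅ a ⁆) ∪ ⁅ c ⁆ ≡⟨ ∪-assoc ⁅ b ⁆ ⁅ a ⁆ ⁅ c ⁆ ⟩
  ⁅ b ⁆ ∪ ⁅ a ⁆ ∪ ⁅ c ⁆   ∎
  where open ≡-Reasoning

triple-swap₂₃ : ∀ (a b c : Fin n) → triple a b c ≡ triple a c b
triple-swap₂₃ a b c = cong (⁅ a ⁆ ∪_) (∪-comm ⁅ b ⁆ ⁅ c ⁆)

module _ {a b c : Fin n} (abc : Distinct a b c) where
  open Distinct abc

  private
    b∉c : b ∉ ⁅ c ⁆
    b∉c = b≢c ∘ x∈⁅y⁆⇒x≡y c

    a∉bc : a ∉ ⁅ b ⁆ ∪ ⁅ c ⁆
    a∉bc a∈ = a≢c (x∈⁅y⁆⇒x≡y c (∈-insert⁻ a≢b a∈))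

  ∣triple∣ : ∣ triple a b c ∣ ≡ 3
  ∣triple∣ = trans (∣insert∣ a∉bc) (cong suc (trans (∣insert∣ b∉c) (cong suc (∣⁅x⁆∣≡1 c))))

  sum-triple : (f : Fin n → ℕ) → ∑[ v < n ] (χ (triple a b c) v * f v) ≡ f a + (f b + f c)
  sum-triple f = begin
    ∑[ v < n ] (χ (triple a b c) v * f v)
      ≡⟨ sum-insert f a∉bc ⟩
    f a + ∑[ v < n ] (χ (⁅ b ⁆ ∪ ⁅ c ⁆) v * f v)
      ≡⟨ cong (f a +_) (sum-insert f b∉c) ⟩
    f a + (f b + ∑[ v < n ] (χ ⁅ c ⁆ v * f v))
      ≡⟨ cong (λ q → f a + (f b + ∑[ v < n ] (χ q v * f v))) (∪-identityʳ ⁅ c ⁆) ⟨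
    f a + (f b + ∑[ v < n ] (χ (⁅ c ⁆ ∪ ⊥) v * f v))
      ≡⟨ cong (λ s → f a + (f b + s)) (sum-insert f ∉⊥) ⟩
    f a + (f b + (f c + ∑[ v < n ] (χ ⊥ v * f v)))
      ≡⟨ cong (λ s → f a + (f b + (f c + s))) (sum-zero λ v → cong (_* f v) (∉⇒χ≡0 {v = v} ∉⊥)) ⟩
    f a + (f b + (f c + 0))
      ≡⟨ cong (λ s → f a + (f b + s)) (+-identityʳ (f c)) ⟩
    f a + (f b + f c) ∎
    where open ≡-Reasoning

-- The elements `u`, `v` and some remaining `w` are split off in turn, each lowering the size by
-- one, until the rest has size 0 and is `⊥`. This supplies the third vertex of an edge through two
-- given vertices.
completion : ∀ {p : Subset n} {u v} → ∣ p ∣ ≡ 3 → u ≢ v → u ∈ p → v ∈ p →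
             ∃[ w ] (Distinct u v w × p ≡ triple u v w)
completion {u = u} {v} ∣p∣≡3 u≢v u∈p v∈p
  with q , u∉q , refl ← ∈⇒insert u∈p
  with v∈q ← ∈-insert⁻ (u≢v ∘ sym) v∈p
  with ∣q∣≡2 ← remove-size u∉q ∣p∣≡3
  with r , v∉r , refl ← ∈⇒insert v∈q
  with ∣r∣≡1 ← remove-size v∉r ∣q∣≡2
  with w , w∈r ← nonempty r ∣r∣≡1
  with s , w∉s , refl ← ∈⇒insert w∈r
  with refl ← ∣p∣≡0⇒p≡⊥ s (remove-size w∉s ∣r∣≡1)
  = w
  , distinct u≢v (λ { refl → v∉r w∈r }) (λ { refl → u∉q (x∈p∪q⁺ (inj₂ w∈r)) })
  , cong (λ s → ⁅ u ⁆ ∪ ⁅ v ⁆ ∪ s) (∪-identityʳ ⁅ w ⁆)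

3-subset : ∀ (p : Subset n) → ∣ p ∣ ≡ 3 → ∃[ a ] ∃[ b ] ∃[ c ] (Distinct a b c × p ≡ triple a b c)
3-subset p ∣p∣≡3 with a , b , a≢b , a∈p , b∈p ← two-elements p ∣p∣≡3
  with c , rest ← completion ∣p∣≡3 a≢b a∈p b∈p = a , b , c , rest

-- The form in which linearity gets verified for the extremal example, where two vertices of a block
-- determine it. The next lemma serves the opposite direction, for using linearity.
∣∩∣≤1 : ∀ (p q : Subset n) → (∀ {u v} → u ≢ v → u ∈ p → v ∈ p → u ∈ q → v ∈ q → p ≡ q) →
        p ≢ q → ∣ p ∩ q ∣ ≤ 1
∣∩∣≤1 p q same p≢q with ∣ p ∩ q ∣ in eq
... | 0 = z≤n
... | 1 = ≤-refl
... | suc (suc _) with u , v , u≢v , u∈ , v∈ ← two-elements (p ∩ q) eq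
  with u∈p , u∈q ← x∈p∩q⁻ p q u∈ | v∈p , v∈q ← x∈p∩q⁻ p q v∈
  = contradiction (same u≢v u∈p v∈p u∈q v∈q) p≢q

2≤∣∩∣ : ∀ {p q : Subset n} {u v} → u ≢ v → u ∈ p → v ∈ p → u ∈ q → v ∈ q → 2 ≤ ∣ p ∩ q ∣
2≤∣∩∣ {p = p} {q} {u} {v} u≢v u∈p v∈p u∈q v∈q = begin
  2                   ≡⟨ cong suc (∣⁅x⁆∣≡1 v) ⟨
  suc ∣ ⁅ v ⁆ ∣       ≡⟨ ∣insert∣ (u≢v ∘ x∈⁅y⁆⇒x≡y v) ⟨
  ∣ ⁅ u ⁆ ∪ ⁅ v ⁆ ∣   ≤⟨ p⊆q⇒∣p∣≤∣q∣ pair⊆ ⟩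
  ∣ p ∩ q ∣           ∎
  where
  open ≤-Reasoning
  pair⊆ : ⁅ u ⁆ ∪ ⁅ v ⁆ ⊆ p ∩ q
  pair⊆ x∈ with x∈p∪q⁻ ⁅ u ⁆ ⁅ v ⁆ x∈
  ... | inj₁ x∈u rewrite x∈⁅y⁆⇒x≡y u x∈u = x∈p∩q⁺ (u∈p , u∈q)
  ... | inj₂ x∈v rewrite x∈⁅y⁆⇒x≡y v x∈v = x∈p∩q⁺ (v∈p , v∈q)

∈-image⁺ : ∀ (φ : Fin m → Fin n) {e i} → i ∈ e → φ i ∈ image φ e
∈-image⁺ φ {inside  ∷ e} here       = x∈p∪q⁺ (inj₁ (x∈⁅x⁆ (φ zero)))
∈-image⁺ φ {inside  ∷ e} (there i∈) = x∈p∪q⁺ (inj₂ (∈-image⁺ (φ ∘ suc) i∈))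
∈-image⁺ φ {outside ∷ e} (there i∈) = ∈-image⁺ (φ ∘ suc) i∈

∈-image⁻ : ∀ (φ : Fin m → Fin n) {e v} → v ∈ image φ e → ∃[ i ] (i ∈ e × φ i ≡ v)
∈-image⁻ φ {[]}          v∈ = contradiction v∈ ∉⊥
∈-image⁻ φ {outside ∷ e} v∈ with i , i∈ , eq ← ∈-image⁻ (φ ∘ suc) v∈ = suc i , there i∈ , eq
∈-image⁻ φ {inside  ∷ e} v∈ with x∈p∪q⁻ ⁅ φ zero ⁆ _ v∈
... | inj₁ v∈₀ = zero , here , sym (x∈⁅y⁆⇒x≡y (φ zero) v∈₀)
... | inj₂ v∈₁ with i , i∈ , eq ← ∈-image⁻ (φ ∘ suc) v∈₁ = suc i , there i∈ , eq

image-triple : ∀ (φ : Fin m → Fin n) i j k → image φ (triple i j k) ≡ triple (φ i) (φ j) (φ k)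
image-triple φ i j k = ⊆-antisym ⊆₁ ⊆₂
  where
  ⊆₁ : image φ (triple i j k) ⊆ triple (φ i) (φ j) (φ k)
  ⊆₁ v∈ with ∈-image⁻ φ v∈
  ... | l , l∈ , refl with ∈-triple⁻ {a = i} {j} {k} l∈
  ...   | inj₁ refl        = fst∈
  ...   | inj₂ (inj₁ refl) = snd∈
  ...   | inj₂ (inj₂ refl) = thd∈
  ⊆₂ : triple (φ i) (φ j) (φ k) ⊆ image φ (triple i j k)
  ⊆₂ v∈ with ∈-triple⁻ {a = φ i} {φ j} {φ k} v∈
  ... | inj₁ refl        = ∈-image⁺ φ (fst∈ {a = i} {j} {k})
  ... | inj₂ (inj₁ refl) = ∈-image⁺ φ (snd∈ {a = i} {j} {k})
  ... | inj₂ (inj₂ refl) = ∈-image⁺ φ (thd∈ {a = i} {j} {k})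

module _ {φ : Fin m → Fin n} (φ-inj : Injective _≡_ _≡_ φ) where

  ∈-image-injective : ∀ {e i} → φ i ∈ image φ e → i ∈ e
  ∈-image-injective {e} φi∈ with j , j∈e , eq ← ∈-image⁻ φ φi∈ = subst (_∈ e) (φ-inj eq) j∈e

  image-injective : ∀ {e f} → image φ e ≡ image φ f → e ≡ f
  image-injective {e} {f} eq = ⊆-antisym
    (λ i∈e → ∈-image-injective (subst (_ ∈_) eq (∈-image⁺ φ i∈e)))
    (λ i∈f → ∈-image-injective (subst (_ ∈_) (sym eq) (∈-image⁺ φ i∈f)))

  image-∩ : ∀ e f → image φ e ∩ image φ f ≡ image φ (e ∩ f)
  image-∩ e f = ⊆-antisym ⊆₁ ⊆₂
    where
    ⊆₁ : image φ e ∩ image φ f ⊆ image φ (e ∩ f)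
    ⊆₁ v∈ with v∈e , v∈f ← x∈p∩q⁻ (image φ e) (image φ f) v∈
      with i , i∈e , refl ← ∈-image⁻ φ {e} v∈e
      = ∈-image⁺ φ (x∈p∩q⁺ (i∈e , ∈-image-injective {f} v∈f))
    ⊆₂ : image φ (e ∩ f) ⊆ image φ e ∩ image φ f
    ⊆₂ v∈ with i , i∈ , refl ← ∈-image⁻ φ {e ∩ f} v∈
      with i∈e , i∈f ← x∈p∩q⁻ e f i∈
      = x∈p∩q⁺ {p = image φ e} {image φ f} (∈-image⁺ φ i∈e , ∈-image⁺ φ i∈f)

∣image∣ : ∀ {φ : Fin m → Fin n} → Injective _≡_ _≡_ φ → ∀ e → ∣ image φ e ∣ ≡ ∣ e ∣
∣image∣ {n = n} _  []            = ∣⊥∣≡0 n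
∣image∣ {φ = φ} φ-inj (inside  ∷ e) = trans
  (∣insert∣ λ φ₀∈ → zero∉ (∈-image⁻ (φ ∘ suc) φ₀∈))
  (cong suc (∣image∣ (Fin.suc-injective ∘ φ-inj) e))
  where
  zero∉ : ¬ (∃[ i ] (i ∈ e × φ (suc i) ≡ φ zero))
  zero∉ (i , _ , eq) with () ← φ-inj eq
∣image∣ φ-inj (outside ∷ e) = ∣image∣ (Fin.suc-injective ∘ φ-inj) e

-- Induced copies and the upper bound

_∈ˢ?_ : ∀ (e : Subset n) es → Dec (e List.∈ es)
_∈ˢ?_ = DecMembership._∈?_ _≟ˢ_

-- Taking `S` to be the whole image makes the restriction to edges inside `S` automatic. Together
-- with `inducedCopy⁻` this replaces induced copies by injections that preserve and reflect edges.
inducedCopy : ∀ {G : Hypergraph m} {H : Hypergraph n} (φ : Fin m → Fin n) → Injective _≡_ _≡_ φ →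
              (∀ e → (e List.∈ edges G) ⇔ (image φ e List.∈ edges H)) → InducedCopy G H
inducedCopy {m} {G = G} {H} φ φ-inj iso = record
  { S    = image φ ⊤
  ; bij  = mk↔ₛ′ to from to-from λ i → φ-inj (φ-from (to i))
  ; edge = λ e → mk⇔
      (λ e∈G → ∈-filter⁺ (_⊆? image φ ⊤) (Equivalence.to (iso e) e∈G) (image⊆ e))
      (λ e∈H → Equivalence.from (iso e) (proj₁ (∈-filter⁻ (_⊆? image φ ⊤) {xs = edges H} e∈H)))
  }
  where
  to : Fin m → ∃ (_∈ image φ ⊤)
  to i = φ i , ∈-image⁺ φ ∈⊤
  from : ∃ (_∈ image φ ⊤) → Fin m
  from (v , v∈) = proj₁ (∈-image⁻ φ {⊤} v∈)
  φ-from : ∀ w → φ (from w) ≡ proj₁ w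
  φ-from (v , v∈) = proj₂ (proj₂ (∈-image⁻ φ {⊤} v∈))
  -- Membership proofs are unique, so a vertex of the image determines its pair.
  pair≡ : ∀ {v w} {v∈ : v ∈ image φ ⊤} {w∈ : w ∈ image φ ⊤} → v ≡ w → (v , v∈) ≡ (w , w∈)
  pair≡ refl = cong (_ ,_) ([]=-irrelevant _ _)
  to-from : ∀ w → to (from w) ≡ w
  to-from w = pair≡ (φ-from w)
  image⊆ : ∀ e → image φ e ⊆ image φ ⊤
  image⊆ e v∈ with i , _ , refl ← ∈-image⁻ φ {e} v∈ = ∈-image⁺ φ ∈⊤

inducedCopy⁻ : ∀ {G : Hypergraph m} {H : Hypergraph n} → InducedCopy G H →
               ∃[ φ ] (Injective _≡_ _≡_ φ × (∀ e → (e List.∈ edges G) ⇔ (image φ e List.∈ edges H)))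
inducedCopy⁻ {m} {n} {H = H} copy = φ , φ-inj , λ e → mk⇔
  (λ e∈G → proj₁ (∈-filter⁻ (_⊆? S) {xs = edges H} (Equivalence.to (edge e) e∈G)))
  (λ e∈H → Equivalence.from (edge e) (∈-filter⁺ (_⊆? S) e∈H (image⊆S e)))
  where
  open InducedCopy copy
  φ : Fin m → Fin n
  φ = proj₁ ∘ Inverse.to bij
  pair≡ : ∀ {w w′ : ∃ (_∈ S)} → proj₁ w ≡ proj₁ w′ → w ≡ w′
  pair≡ refl = cong (_ ,_) ([]=-irrelevant _ _)
  φ-inj : Injective _≡_ _≡_ φ
  φ-inj = Injection.injective (↔⇒↣ bij) ∘ pair≡
  image⊆S : ∀ e → image φ e ⊆ S
  image⊆S e v∈ with i , _ , refl ← ∈-image⁻ φ {e} v∈ = proj₂ (Inverse.to bij i)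

-- Satisfied by every edge that a linear 3-graph containing G has on the vertices of G.
Compatible : Hypergraph m → Subset m → Set
Compatible G e = ∣ e ∣ ≡ 3 × All (λ f → e ≡ f ⊎ ∣ e ∩ f ∣ ≤ 1) (edges G)

compatible? : ∀ (G : Hypergraph m) → Decidable (Compatible G)
compatible? G e = (∣ e ∣ ≟ 3) ×-dec all? (λ f → (e ≟ˢ f) ⊎-dec (∣ e ∩ f ∣ ≤? 1)) (edges G)

-- Checked over all 64 subsets. A corner of the 3-cycle shares an edge with every vertex except the
-- middle of the opposite side, so a new edge avoids the corners and consists of the three middle
-- vertices.
compatible-W³ : ∀ e → Compatible W³ e → e List.∈ (triple (# 1) (# 3) (# 5) ∷ edges W³)
compatible-W³ e comp = decidable-stable (e ∈ˢ? _) λ e∉ → none (e , comp , e∉)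
  where
  none = from-no (anySubset? λ e → compatible? W³ e ×-dec ¬? (e ∈ˢ? (triple (# 1) (# 3) (# 5) ∷ edges W³)))

-- Any two points of the Fano plane lie on a line, so no further triple can be added linearly. Hence
-- every embedded Fano plane in a linear 3-graph is induced. The proof is a check over all 128
-- subsets.
compatible-F₇ : ∀ e → Compatible F₇ e → e List.∈ edges F₇
compatible-F₇ e comp = decidable-stable (e ∈ˢ? _) λ e∉ → none (e , comp , e∉)
  where
  none = from-no (anySubset? λ e → compatible? F₇ e ×-dec ¬? (e ∈ˢ? edges F₇))

-- Edges are counted by their positions in the list; this identifies positions that carry the same
-- edge.
Unique⇒lookup-injective : ∀ {A : Set} {xs : List A} → Unique xs → Injective _≡_ _≡_ (List.lookup xs)
Unique⇒lookup-injective (x∉ ∷ _)  {zero}  {zero}  eq = refl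
Unique⇒lookup-injective (x∉ ∷ _)  {zero}  {suc j} eq = contradiction eq (All.lookup x∉ (∈-lookup j))
Unique⇒lookup-injective (x∉ ∷ _)  {suc i} {zero}  eq = contradiction (sym eq) (All.lookup x∉ (∈-lookup i))
Unique⇒lookup-injective (_ ∷ xs!) {suc i} {suc j} eq = cong suc (Unique⇒lookup-injective xs! eq)

-- Triangles and Fano planes in a linear 3-graph

module Linear3Graph (H : Hypergraph n) (uniform : Uniform 3 H) (linear : Linear H) where

  shared-pair : ∀ {e f u v} → e List.∈ edges H → f List.∈ edges H → u ≢ v →
                u ∈ e → v ∈ e → u ∈ f → v ∈ f → e ≡ f
  shared-pair {e} {f} e∈H f∈H u≢v u∈e v∈e u∈f v∈f = decidable-stable (e ≟ˢ f) λ e≢f →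
    contradiction (2≤∣∩∣ u≢v u∈e v∈e u∈f v∈f) (≤⇒≯ (linear e∈H f∈H e≢f))

  -- An edge with its vertices in a chosen order, so that corners and middle vertices of a
  -- configuration can be named. The swaps below generate all reorderings.
  record Line (a b c : Fin n) : Set where
    constructor line
    field
      a,b,c-distinct : Distinct a b c
      abc∈H          : triple a b c List.∈ edges H
    open Distinct a,b,c-distinct public

  open Line

  swap₁₂ : ∀ {a b c} → Line a b c → Line b a c
  swap₁₂ {a} {b} {c} (line (distinct a≢b b≢c a≢c) abc) =
    line (distinct (a≢b ∘ sym) a≢c b≢c) (subst (List._∈ _) (triple-swap₁₂ a b c) abc)

  swap₂₃ : ∀ {a b c} → Line a b c → Line a c b
  swap₂₃ {a} {b} {c} (line (distinct a≢b b≢c a≢c) abc) =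
    line (distinct a≢c (b≢c ∘ sym) a≢b) (subst (List._∈ _) (triple-swap₂₃ a b c) abc)

  swap₁₃ : ∀ {a b c} → Line a b c → Line c b a
  swap₁₃ = swap₁₂ ∘ swap₂₃ ∘ swap₁₂

  -- Both edges contain `a` and `b`, so they coincide, and `c` can only be `d`.
  line-unique : ∀ {a b c d} → Line a b c → Line a b d → c ≡ d
  line-unique {a} {b} {c} {d} abc abd
    with ∈-triple⁻ (subst (c ∈_) (shared-pair (abc∈H abc) (abc∈H abd) (a≢b abc)
                      fst∈ (snd∈ {a = a}) fst∈ (snd∈ {a = a})) (thd∈ {a = a} {b}))
  ... | inj₁ c≡a        = contradiction (sym c≡a) (a≢c abc)
  ... | inj₂ (inj₁ c≡b) = contradiction (sym c≡b) (b≢c abc)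
  ... | inj₂ (inj₂ c≡d) = c≡d

  line-through : ∀ {e u v} → e List.∈ edges H → u ≢ v → u ∈ e → v ∈ e → ∃[ w ] Line u v w
  line-through e∈H u≢v u∈e v∈e
    with w , uvw , refl ← completion (uniform e∈H) u≢v u∈e v∈e = w , line uvw e∈H

  -- An edge-preserving injection can fail to be induced only at a non-edge of `G` that is
  -- compatible with `G`. This reduces inducedness to the finite checks above.
  image-compatible : ∀ {G : Hypergraph m} {φ : Fin m → Fin n} → Injective _≡_ _≡_ φ →
                     (∀ {e} → e List.∈ edges G → image φ e List.∈ edges H) →
                     ∀ {e} → image φ e List.∈ edges H → Compatible G e
  image-compatible {φ = φ} φ-inj hom {e} φe∈H =
    trans (sym (∣image∣ φ-inj e)) (uniform φe∈H) , All.tabulate meet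
    where
    meet : ∀ {f} → f List.∈ _ → e ≡ f ⊎ ∣ e ∩ f ∣ ≤ 1
    meet {f} f∈G with e ≟ˢ f
    ... | yes e≡f = inj₁ e≡f
    ... | no  e≢f = inj₂ (begin
      ∣ e ∩ f ∣                 ≡⟨ ∣image∣ φ-inj (e ∩ f) ⟨
      ∣ image φ (e ∩ f) ∣       ≡⟨ cong ∣_∣ (image-∩ φ-inj e f) ⟨
      ∣ image φ e ∩ image φ f ∣ ≤⟨ linear φe∈H (hom f∈G) (e≢f ∘ image-injective φ-inj) ⟩
      1                         ∎)
      where open ≤-Reasoning

  image-line : ∀ (φ : Fin m → Fin n) {i j k} → Line (φ i) (φ j) (φ k) →
               image φ (triple i j k) List.∈ edges H
  image-line φ {i} {j} {k} l = subst (List._∈ edges H) (sym (image-triple φ i j k)) (abc∈H l)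

  module _ (free : InducedFree 𝒲³,F₇ H) where

    -- The triangle p, q, r with its three sides is a linear 3-cycle, and the
    -- only further edge that linearity allows on its six vertices is {x , y , z}.
    triangle-closes : ∀ {p q r x y z} → Line p x q → Line q y r → Line r z p → p ≢ y → Line x y z
    triangle-closes {p} {q} {r} {x} {y} {z} pxq qyr rzp p≢y =
      line (distinct x≢y y≢z x≢z) (decidable-stable (triple x y z ∈ˢ? edges H) λ xyz∉H →
        contradiction (inducedCopy φ φ-inj λ e → mk⇔ hom (reflect xyz∉H)) (All.head free))
      where
      -- If a middle vertex equalled the opposite corner, two sides would share two corners and
      -- hence coincide, forcing `p ≡ y`. If two middle vertices were equal, `line-unique` would
      -- identify two corners.
      q≢z : q ≢ z
      q≢z refl = p≢y (line-unique (swap₁₂ rzp) (swap₂₃ qyr))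
      r≢x : r ≢ x
      r≢x refl = p≢y (line-unique (swap₁₃ pxq) (swap₂₃ qyr))
      x≢y : x ≢ y
      x≢y refl = a≢c rzp (sym (line-unique (swap₁₃ pxq) qyr))
      y≢z : y ≢ z
      y≢z refl = a≢c pxq (sym (line-unique (swap₁₃ qyr) rzp))
      x≢z : x ≢ z
      x≢z refl = a≢c qyr (line-unique pxq (swap₁₃ rzp))

      vs : Vec (Fin n) 6
      -- Corners take positions 0, 2, 4 and middle vertices positions 1, 3, 5, as in `W³`.
      vs = p ∷ x ∷ q ∷ y ∷ r ∷ z ∷ []
      vs! : Vec.Unique vs
      vs! = (a≢b pxq ∷ a≢c pxq ∷ p≢y ∷ a≢c rzp ∘ sym ∷ b≢c rzp ∘ sym ∷ [])
          ∷ (b≢c pxq ∷ x≢y ∷ r≢x ∘ sym ∷ x≢z ∷ [])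
          ∷ (a≢b qyr ∷ a≢c qyr ∷ q≢z ∷ [])
          ∷ (b≢c qyr ∷ y≢z ∷ [])
          ∷ (a≢b rzp ∷ [])
          ∷ []
          ∷ []
      φ : Fin 6 → Fin n
      φ = lookup vs
      φ-inj : Injective _≡_ _≡_ φ
      φ-inj = lookup-injective vs! _ _
      hom : ∀ {e} → e List.∈ edges W³ → image φ e List.∈ edges H
      hom (here refl)                 = image-line φ {# 0} {# 1} {# 2} pxq
      hom (there (here refl))         = image-line φ {# 2} {# 3} {# 4} qyr
      hom (there (there (here refl))) = image-line φ {# 4} {# 5} {# 0} rzp
      reflect : ¬ (triple x y z List.∈ edges H) →
                ∀ {e} → image φ e List.∈ edges H → e List.∈ edges W³
      reflect xyz∉H {e} φe∈H with compatible-W³ e (image-compatible {G = W³} φ-inj hom φe∈H)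
      ... | here refl = contradiction (subst (List._∈ edges H) (image-triple φ (# 1) (# 3) (# 5)) φe∈H) xyz∉H
      ... | there e∈W = e∈W

    -- Otherwise the three triangles through p close up to a Fano plane.
    not-all-collinear : ∀ {a b c p x y z} → Line a b c → Line p a x → Line p b y → ¬ Line p c z
    not-all-collinear {a} {b} {c} {p} {x} {y} {z} abc pax pby pcz =
      All.head (All.tail free) (inducedCopy φ φ-inj λ e → mk⇔ hom
        (compatible-F₇ e ∘ image-compatible {G = F₇} φ-inj hom))
      where
      -- Each triangle has as corners `p` and two of `a`, `b`, `c`; the remaining one of these is
      -- the middle vertex of the side opposite `p`.
      xcy : Line x c y
      xcy = triangle-closes (swap₂₃ pax) (swap₂₃ abc) (swap₂₃ (swap₁₂ pby)) (a≢b pcz)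
      xbz : Line x b z
      xbz = triangle-closes (swap₂₃ pax) abc (swap₂₃ (swap₁₂ pcz)) (a≢b pby)
      yaz : Line y a z
      yaz = triangle-closes (swap₂₃ pby) (swap₁₂ abc) (swap₂₃ (swap₁₂ pcz)) (a≢b pax)

      vs : Vec (Fin n) 7
      -- The order matches `nonzeroVectors`: `a`, `b`, `p` become the unit vectors 001, 010, 100,
      -- `c` is a + b, and `x`, `y`, `z` are p + a, p + b, p + c.
      vs = a ∷ b ∷ c ∷ p ∷ x ∷ y ∷ z ∷ []
      vs! : Vec.Unique vs
      vs! = (a≢b abc ∷ a≢c abc ∷ a≢b pax ∘ sym ∷ b≢c pax ∷ a≢b yaz ∘ sym ∷ b≢c yaz ∷ [])
          ∷ (b≢c abc ∷ a≢b pby ∘ sym ∷ a≢b xbz ∘ sym ∷ b≢c pby ∷ b≢c xbz ∷ [])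
          ∷ (a≢b pcz ∘ sym ∷ a≢b xcy ∘ sym ∷ b≢c xcy ∷ b≢c pcz ∷ [])
          ∷ (a≢c pax ∷ a≢c pby ∷ a≢c pcz ∷ [])
          ∷ (a≢c xcy ∷ a≢c xbz ∷ [])
          ∷ (a≢c yaz ∷ [])
          ∷ []
          ∷ []
      φ : Fin 7 → Fin n
      φ = lookup vs
      φ-inj : Injective _≡_ _≡_ φ
      φ-inj = lookup-injective vs! _ _
      homs : All (λ e → image φ e List.∈ edges H) (edges F₇)
      -- The lines appear in the order in which filtering `subsets 7` evaluates.
      homs = image-line φ {# 0} {# 1} {# 2} abc
           ∷ image-line φ {# 3} {# 0} {# 4} pax
           ∷ image-line φ {# 5} {# 0} {# 6} yaz
           ∷ image-line φ {# 3} {# 1} {# 5} pby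
           ∷ image-line φ {# 4} {# 1} {# 6} xbz
           ∷ image-line φ {# 3} {# 2} {# 6} pcz
           ∷ image-line φ {# 4} {# 2} {# 5} xcy
           ∷ []
      hom : ∀ {e} → e List.∈ edges F₇ → image φ e List.∈ edges H
      hom = All.lookup homs

    -- Codegree bounds and the degree count

    edgeAt : Fin (#edges H) → Subset n
    edgeAt = List.lookup (edges H)

    M : Fin (#edges H) → Fin n → ℕ
    M i = χ (edgeAt i)

    open Incidence M

    edgeAt∈H : ∀ i → edgeAt i List.∈ edges H
    edgeAt∈H = ∈-lookup

    codegree-self : ∀ v → codegree v v ≡ degree v
    codegree-self v = sum-cong-≗ λ i → idem (χ≤1 (edgeAt i) v)
      where
      idem : ∀ {x} → x ≤ 1 → x * x ≡ x
      idem z≤n       = refl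
      idem (s≤s z≤n) = refl

    codegree≤1 : ∀ {v w} → v ≢ w → codegree v w ≤ 1
    codegree≤1 {v} {w} v≢w = sum≤1 (λ i → M i v * M i w)
      (λ i → *-mono-≤ (χ≤1 (edgeAt i) v) (χ≤1 (edgeAt i) w)) single
      where
      single : ∀ i j → 0 < M i v * M i w → 0 < M j v * M j w → i ≡ j
      single i j i>0 j>0 with vi , wi ← product>0 i>0 | vj , wj ← product>0 j>0 =
        Unique⇒lookup-injective (unique H) (shared-pair (edgeAt∈H i) (edgeAt∈H j) v≢w
          (χ>0⇒∈ _ vi) (χ>0⇒∈ _ wi) (χ>0⇒∈ _ vj) (χ>0⇒∈ _ wj))

    codegree>0⇒line : ∀ {v w} → v ≢ w → 0 < codegree v w → ∃[ x ] Line w v x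
    codegree>0⇒line {v} {w} v≢w pos
      with i , i>0 ← sum>0⇒∃ (λ i → M i v * M i w) pos
      with vi , wi ← product>0 i>0 = line-through (edgeAt∈H i) (v≢w ∘ sym) (χ>0⇒∈ _ wi) (χ>0⇒∈ _ vi)

    -- For `w` outside the edge, the three codegrees are at most 1 and cannot all be positive, since
    -- that would give the three lines excluded by `not-all-collinear`. For `w` on the edge, its own
    -- term is its degree and the other two are at most 1.
    line-codegree : ∀ {a b c} → Line a b c → ∀ w →
      codegree a w + (codegree b w + codegree c w) ≤ 2 + χ (triple a b c) w * degree w
    line-codegree {a} {b} {c} abc w with w ∈? triple a b c
    ... | no w∉ = ≤-trans (three≤2 (codegree≤1 a≢w) (codegree≤1 b≢w) (codegree≤1 c≢w) not-all)
                    (m≤m+n 2 _)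
      where
      a≢w : a ≢ w
      a≢w refl = w∉ fst∈
      b≢w : b ≢ w
      b≢w refl = w∉ (snd∈ {a = a})
      c≢w : c ≢ w
      c≢w refl = w∉ (thd∈ {a = a} {b})
      three≤2 : ∀ {x y z} → x ≤ 1 → y ≤ 1 → z ≤ 1 → ¬ (0 < x × 0 < y × 0 < z) → x + (y + z) ≤ 2
      three≤2 z≤n       y≤1       z≤1       _ = +-mono-≤ y≤1 z≤1
      three≤2 (s≤s z≤n) z≤n       z≤1       _ = s≤s z≤1
      three≤2 (s≤s z≤n) (s≤s z≤n) z≤n       _ = ≤-refl
      three≤2 (s≤s z≤n) (s≤s z≤n) (s≤s z≤n) h = contradiction (z<s , z<s , z<s) h
      not-all : ¬ (0 < codegree a w × 0 < codegree b w × 0 < codegree c w)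
      not-all (a>0 , b>0 , c>0) = not-all-collinear abc
        (proj₂ (codegree>0⇒line a≢w a>0)) (proj₂ (codegree>0⇒line b≢w b>0)) (proj₂ (codegree>0⇒line c≢w c>0))
    ... | yes w∈ rewrite ∈⇒χ≡1 w∈ | *-identityˡ (degree w) with ∈-triple⁻ {a = a} {b} {c} w∈
    ...   | inj₁ refl = begin
      codegree a a + (codegree b a + codegree c a)
        ≤⟨ +-mono-≤ (≤-reflexive (codegree-self a))
             (+-mono-≤ (codegree≤1 (a≢b abc ∘ sym)) (codegree≤1 (a≢c abc ∘ sym))) ⟩
      degree a + 2 ≡⟨ +-comm (degree a) 2 ⟩
      2 + degree a ∎
      where open ≤-Reasoning
    ...   | inj₂ (inj₁ refl) = begin
      codegree a b + (codegree b b + codegree c b)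
        ≤⟨ +-mono-≤ (codegree≤1 (a≢b abc))
             (+-mono-≤ (≤-reflexive (codegree-self b)) (codegree≤1 (b≢c abc ∘ sym))) ⟩
      1 + (degree b + 1) ≡⟨ cong suc (+-comm (degree b) 1) ⟩
      2 + degree b ∎
      where open ≤-Reasoning
    ...   | inj₂ (inj₂ refl) =
      +-mono-≤ (codegree≤1 (a≢c abc)) (+-mono-≤ (codegree≤1 (b≢c abc)) (≤-reflexive (codegree-self c)))

    edge-codegree : ∀ i w → ∑[ v < n ] (M i v * codegree v w) ≤ 2 + M i w * degree w
    edge-codegree i w = helper (edgeAt∈H i)
      where
      -- Stated for a variable `e`, so that matching can replace it by a triple; `edgeAt i` itself
      -- cannot be unified with one.
      helper : ∀ {e} → e List.∈ edges H → ∑[ v < n ] (χ e v * codegree v w) ≤ 2 + χ e w * degree w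
      helper {e} e∈H with a , b , c , abc , refl ← 3-subset e (uniform e∈H) =
        ≤-trans (≤-reflexive (sum-triple abc (λ v → codegree v w))) (line-codegree (line abc e∈H) w)

    9*#edges≤n² : 9 * #edges H ≤ n ^ 2
    9*#edges≤n² = 9m≤n² 3-uniform λ i → edge-degree-sum 3-uniform i (edge-codegree i)
      where
      3-uniform : ∀ i → ∑[ v < n ] M i v ≡ 3
      3-uniform i = trans (sum-χ (edgeAt i)) (uniform (edgeAt∈H i))

-- The extremal construction

length-cartesianProduct : ∀ {A B : Set} (xs : List A) (ys : List B) →
                          length (cartesianProduct xs ys) ≡ length xs * length ys
length-cartesianProduct []       ys = refl
length-cartesianProduct (x ∷ xs) ys = trans (length-++ (map (x ,_) ys))
  (cong₂ _+_ (length-map (x ,_) ys) (length-cartesianProduct xs ys))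

𝔽₂^ : ℕ → Set
𝔽₂^ = Vec Bool

infixl 6 _+ᵥ_
_+ᵥ_ : 𝔽₂^ k → 𝔽₂^ k → 𝔽₂^ k
_+ᵥ_ = zipWith _xor_

+ᵥ-comm : ∀ (u v : 𝔽₂^ k) → u +ᵥ v ≡ v +ᵥ u
+ᵥ-comm = zipWith-comm xor-comm

+ᵥ-assoc : ∀ (u v w : 𝔽₂^ k) → u +ᵥ v +ᵥ w ≡ u +ᵥ (v +ᵥ w)
+ᵥ-assoc = zipWith-assoc xor-assoc

+ᵥ-cancel : ∀ (u v : 𝔽₂^ k) → u +ᵥ (u +ᵥ v) ≡ v
+ᵥ-cancel []      []      = refl
+ᵥ-cancel (a ∷ u) (b ∷ v) = cong₂ _∷_
  (trans (sym (xor-assoc a a b)) (cong (_xor b) (xor-same a))) (+ᵥ-cancel u v)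

-- Equivalent to u + v + w = 0, hence symmetric in u, v, w.
ZeroSum : (u v w : 𝔽₂^ k) → Set
ZeroSum u v w = u +ᵥ v ≡ w

zeroSum-swap₁₂ : ∀ {u v w : 𝔽₂^ k} → ZeroSum u v w → ZeroSum v u w
zeroSum-swap₁₂ {u = u} {v} eq = trans (+ᵥ-comm v u) eq

zeroSum-swap₂₃ : ∀ {u v w : 𝔽₂^ k} → ZeroSum u v w → ZeroSum u w v
zeroSum-swap₂₃ {u = u} {v} refl = +ᵥ-cancel u v

-- In characteristic 2 the sum (p + q) + (q + r) + (r + p) vanishes. This is why every triangle of
-- the transversal design closes up to a Pasch configuration.
zeroSum-closes : ∀ {p q r x y z : 𝔽₂^ k} → ZeroSum p q x → ZeroSum q r y → ZeroSum r p z → ZeroSum x y z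
zeroSum-closes {p = p} {q} {r} refl refl refl = begin
  p +ᵥ q +ᵥ (q +ᵥ r)   ≡⟨ +ᵥ-assoc p q (q +ᵥ r) ⟩
  p +ᵥ (q +ᵥ (q +ᵥ r)) ≡⟨ cong (p +ᵥ_) (+ᵥ-cancel q r) ⟩
  p +ᵥ r               ≡⟨ +ᵥ-comm p r ⟩
  r +ᵥ p               ∎
  where open ≡-Reasoning

enumeration : ∀ k → 𝔽₂^ k ↔ Fin (2 ^ k)
enumeration zero    = mk↔ₛ′ (λ _ → zero) (λ _ → []) (λ { zero → refl }) (λ { [] → refl })
enumeration (suc k) =
  ↔-sym Fin.*↔× ↔-∘ ((↔-sym Fin.2↔Bool ×-↔ enumeration k) ↔-∘ uncons)
  where
  uncons : 𝔽₂^ (suc k) ↔ (Bool × 𝔽₂^ k)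
  uncons = mk↔ₛ′ Vec.uncons (uncurry _∷_) (λ _ → refl) (λ { (_ ∷ _) → refl })

-- The two adjacent transpositions generate all permutations of three colours, so an invariant
-- property need only be checked for one order.
Fin3-distinct-elim : (P : Fin 3 → Fin 3 → Fin 3 → Set) →
  (∀ {i j l} → P i j l → P j i l) → (∀ {i j l} → P i j l → P i l j) →
  P (# 0) (# 1) (# 2) → ∀ {i j l} → Distinct i j l → P i j l
Fin3-distinct-elim P s₁₂ s₂₃ base {i} {j} {l} (distinct i≢j j≢l i≢l) = go i j l i≢j j≢l i≢l
  where
  go : ∀ i j l → i ≢ j → j ≢ l → i ≢ l → P i j l
  go zero             (suc zero)       (suc (suc zero)) _ _ _ = base
  go (suc zero)       zero             (suc (suc zero)) _ _ _ = s₁₂ base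
  go zero             (suc (suc zero)) (suc zero)       _ _ _ = s₂₃ base
  go (suc zero)       (suc (suc zero)) zero             _ _ _ = s₂₃ (s₁₂ base)
  go (suc (suc zero)) zero             (suc zero)       _ _ _ = s₁₂ (s₂₃ base)
  go (suc (suc zero)) (suc zero)       zero             _ _ _ = s₁₂ (s₂₃ (s₁₂ base))
  go zero             zero             _                i≢j _ _ = contradiction refl i≢j
  go (suc zero)       (suc zero)       _                i≢j _ _ = contradiction refl i≢j
  go (suc (suc zero)) (suc (suc zero)) _                i≢j _ _ = contradiction refl i≢j
  go _                zero             zero             _ j≢l _ = contradiction refl j≢l
  go _                (suc zero)       (suc zero)       _ j≢l _ = contradiction refl j≢l
  go _                (suc (suc zero)) (suc (suc zero)) _ j≢l _ = contradiction refl j≢l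
  go zero             _                zero             _ _ i≢l = contradiction refl i≢l
  go (suc zero)       _                (suc zero)       _ _ i≢l = contradiction refl i≢l
  go (suc (suc zero)) _                (suc (suc zero)) _ _ i≢l = contradiction refl i≢l

-- Used to identify the colour of a middle vertex with that of the opposite corner.
Fin3-third : ∀ (i j l i′ : Fin 3) → i ≢ j → j ≢ l → i ≢ l → i′ ≢ j → i′ ≢ l → i′ ≡ i
Fin3-third = from-yes (Fin.all? {3} λ i → Fin.all? {3} λ j → Fin.all? {3} λ l → Fin.all? {3} λ i′ →
  ¬? (i Fin.≟ j) →-dec ¬? (j Fin.≟ l) →-dec ¬? (i Fin.≟ l) →-dec
  ¬? (i′ Fin.≟ j) →-dec ¬? (i′ Fin.≟ l) →-dec (i′ Fin.≟ i))

135∉W³ : ¬ (triple (# 1) (# 3) (# 5) List.∈ edges W³)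
135∉W³ = from-no (triple (# 1) (# 3) (# 5) ∈ˢ? edges W³)

F₇-line-through : ∀ i j → i ≢ j → ∃[ l ] (j ≢ l × i ≢ l × triple i j l List.∈ edges F₇)
F₇-line-through = from-yes (Fin.all? {7} λ i → Fin.all? {7} λ j → ¬? (i Fin.≟ j) →-dec
  Fin.any? {7} λ l → ¬? (j Fin.≟ l) ×-dec ¬? (i Fin.≟ l) ×-dec (triple i j l ∈ˢ? edges F₇))

-- The transversal design and its lines

module Transversal (k : ℕ) where

  V : Set
  V = Fin (3 * 2 ^ k)

  encode : 𝔽₂^ k → Fin (2 ^ k)
  encode = Inverse.to (enumeration k)

  decode : Fin (2 ^ k) → 𝔽₂^ k
  decode = Inverse.from (enumeration k)

  decode-encode : ∀ u → decode (encode u) ≡ u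
  decode-encode = Inverse.strictlyInverseʳ (enumeration k)

  decode-injective : Injective _≡_ _≡_ decode
  decode-injective = Injection.injective (↔⇒↣ (↔-sym (enumeration k)))

  vertex : Fin 3 → 𝔽₂^ k → V
  vertex i u = combine i (encode u)

  colour : V → Fin 3
  colour a = proj₁ (remQuot {3} (2 ^ k) a)

  value : V → 𝔽₂^ k
  value a = decode (proj₂ (remQuot {3} (2 ^ k) a))

  colour-vertex : ∀ i u → colour (vertex i u) ≡ i
  colour-vertex i u = cong proj₁ (Fin.remQuot-combine i (encode u))

  value-vertex : ∀ i u → value (vertex i u) ≡ u
  value-vertex i u = trans (cong (decode ∘ proj₂) (Fin.remQuot-combine i (encode u))) (decode-encode u)

  vertex-colour-value : ∀ a → vertex (colour a) (value a) ≡ a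
  vertex-colour-value a = trans
    (cong (combine (colour a)) (Inverse.strictlyInverseˡ (enumeration k) _))
    (Fin.combine-remQuot {3} (2 ^ k) a)

  vertex≡ : ∀ {a b} → colour a ≡ colour b → value a ≡ value b → a ≡ b
  vertex≡ {a} {b} c≡ v≡ = trans (sym (vertex-colour-value a))
    (trans (cong₂ vertex c≡ v≡) (vertex-colour-value b))

  -- The block of `u` and `v` seen as a function of the colour: it has exactly one vertex of each
  -- colour, with this value.
  coordinate : 𝔽₂^ k → 𝔽₂^ k → Fin 3 → 𝔽₂^ k
  coordinate u v zero             = u
  coordinate u v (suc zero)       = v
  coordinate u v (suc (suc zero)) = u +ᵥ v

  -- Two free vectors suffice as parameters, since the third is forced to be their sum in
  -- characteristic 2. This gives the square of `2 ^ k` as the number of blocks.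
  block : 𝔽₂^ k → 𝔽₂^ k → Subset (3 * 2 ^ k)
  block u v = triple (vertex (# 0) u) (vertex (# 1) v) (vertex (# 2) (u +ᵥ v))

  ∈-block⁻ : ∀ {u v a} → a ∈ block u v → value a ≡ coordinate u v (colour a)
  ∈-block⁻ {u} {v} {a} a∈ = [ at (# 0) , [ at (# 1) , at (# 2) ]′ ]′ (∈-triple⁻ a∈)
    where
    at : ∀ i → a ≡ vertex i (coordinate u v i) → value a ≡ coordinate u v (colour a)
    at i refl = trans (value-vertex i _) (cong (coordinate u v) (sym (colour-vertex i _)))

  -- Any two of u, v, u + v determine the third: v is u + (u + v), and u is v + (u + v).
  coordinates-determine-block : ∀ {u v u′ v′} i j → i ≢ j →
    coordinate u v i ≡ coordinate u′ v′ i → coordinate u v j ≡ coordinate u′ v′ j → block u v ≡ block u′ v′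
  coordinates-determine-block {u} {v} {u′} {v′} = go
    where
    Agree : Fin 3 → Set
    Agree i = coordinate u v i ≡ coordinate u′ v′ i
    agree₀₁ : Agree (# 0) → Agree (# 1) → block u v ≡ block u′ v′
    agree₀₁ = cong₂ block
    agree₀₂ : Agree (# 0) → Agree (# 2) → block u v ≡ block u′ v′
    agree₀₂ p q = agree₀₁ p
      (trans (sym (+ᵥ-cancel u v)) (trans (cong₂ _+ᵥ_ p q) (+ᵥ-cancel u′ v′)))
    agree₁₂ : Agree (# 1) → Agree (# 2) → block u v ≡ block u′ v′
    agree₁₂ p q = agree₀₁ (trans (sym (third u v)) (trans (cong₂ _+ᵥ_ p q) (third u′ v′))) p
      where
      third : ∀ s t → ZeroSum t (s +ᵥ t) s
      third s t = zeroSum-swap₂₃ (zeroSum-swap₁₂ {u = s} refl)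
    go : ∀ i j → i ≢ j → Agree i → Agree j → block u v ≡ block u′ v′
    go zero             (suc zero)       _ p q = agree₀₁ p q
    go (suc zero)       zero             _ p q = agree₀₁ q p
    go zero             (suc (suc zero)) _ p q = agree₀₂ p q
    go (suc (suc zero)) zero             _ p q = agree₀₂ q p
    go (suc zero)       (suc (suc zero)) _ p q = agree₁₂ p q
    go (suc (suc zero)) (suc zero)       _ p q = agree₁₂ q p
    go zero             zero             i≢i _ _ = contradiction refl i≢i
    go (suc zero)       (suc zero)       i≢i _ _ = contradiction refl i≢i
    go (suc (suc zero)) (suc (suc zero)) i≢i _ _ = contradiction refl i≢i

  block-colours-differ : ∀ {u v a b} → a ∈ block u v → b ∈ block u v → a ≢ b → colour a ≢ colour b
  block-colours-differ {u} {v} a∈ b∈ a≢b c≡ = a≢b (vertex≡ c≡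
    (trans (∈-block⁻ a∈) (trans (cong (coordinate u v) c≡) (sym (∈-block⁻ b∈)))))

  block-injective : ∀ {u v u′ v′} → block u v ≡ block u′ v′ → u ≡ u′ × v ≡ v′
  block-injective {u} {v} {u′} {v′} eq = at (# 0) fst∈ , at (# 1) (snd∈ {a = vertex (# 0) u})
    where
    at : ∀ i → vertex i (coordinate u v i) ∈ block u v → coordinate u v i ≡ coordinate u′ v′ i
    at i a∈ = trans (sym (value-vertex i _))
      (trans (∈-block⁻ (subst (_ ∈_) eq a∈)) (cong (coordinate u′ v′) (colour-vertex i _)))

  block′ : Fin (2 ^ k) × Fin (2 ^ k) → Subset (3 * 2 ^ k)
  block′ (i , j) = block (decode i) (decode j)

  indices : List (Fin (2 ^ k) × Fin (2 ^ k))
  indices = cartesianProduct (allFin (2 ^ k)) (allFin (2 ^ k))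

  T : Hypergraph (3 * 2 ^ k)
  T = record
    { edges  = map block′ indices
    ; unique = Unique.map⁺ block′-injective
                 (Unique.cartesianProduct⁺ (Unique.allFin⁺ (2 ^ k)) (Unique.allFin⁺ (2 ^ k)))
    }
    where
    block′-injective : ∀ {x y} → block′ x ≡ block′ y → x ≡ y
    block′-injective {i , j} {i′ , j′} eq with u≡ , v≡ ← block-injective {decode i} {decode j} eq =
      cong₂ _,_ (decode-injective u≡) (decode-injective v≡)

  #edges-T : #edges T ≡ 2 ^ k * 2 ^ k
  #edges-T = trans (length-map block′ indices) (trans
    (length-cartesianProduct (allFin (2 ^ k)) (allFin (2 ^ k)))
    (cong₂ _*_ (length-tabulate {n = 2 ^ k} _) (length-tabulate {n = 2 ^ k} _)))

  block∈T : ∀ u v → block u v List.∈ edges T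
  block∈T u v = subst (List._∈ edges T) (cong₂ block (decode-encode u) (decode-encode v))
    (∈-map⁺ block′ (∈-cartesianProduct⁺ (∈-allFin (encode u)) (∈-allFin (encode v))))

  ∈T⁻ : ∀ {e} → e List.∈ edges T → ∃₂ λ u v → e ≡ block u v
  ∈T⁻ e∈ with (i , j) , _ , refl ← ∈-map⁻ block′ e∈ = decode i , decode j , refl

  -- A description of the edges of `T` that does not depend on which vertex has which colour;
  -- `triple∈T⁺` and `triple∈T⁻` justify it.
  record Collinear (a b c : V) : Set where
    constructor collinear
    field
      rainbow : Distinct (colour a) (colour b) (colour c)
      zeroSum : ZeroSum (value a) (value b) (value c)

  triple∈T⁺ : ∀ {a b c} → Collinear a b c → triple a b c List.∈ edges T
  triple∈T⁺ {a} {b} {c} (collinear rainbow zs) = subst (List._∈ edges T) eq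
    -- The property quantifies over the values, so that they can be permuted together with the
    -- colours. In the standard order the triple is a block.
    (Fin3-distinct-elim (λ i j l → ∀ {u v w} → ZeroSum u v w →
        triple (vertex i u) (vertex j v) (vertex l w) List.∈ edges T)
      (λ P zs → subst (List._∈ edges T) (triple-swap₁₂ _ _ _) (P (zeroSum-swap₁₂ zs)))
      (λ P zs → subst (List._∈ edges T) (triple-swap₂₃ _ _ _) (P (zeroSum-swap₂₃ zs)))
      (λ { refl → block∈T _ _ })
      rainbow zs)
    where
    eq : triple (vertex (colour a) (value a)) (vertex (colour b) (value b)) (vertex (colour c) (value c))
         ≡ triple a b c
    eq = cong₂ _∪_ (cong ⁅_⁆ (vertex-colour-value a))
      (cong₂ (λ b c → ⁅ b ⁆ ∪ ⁅ c ⁆) (vertex-colour-value b) (vertex-colour-value c))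

  triple∈T⁻ : ∀ {a b c} → Distinct a b c → triple a b c List.∈ edges T → Collinear a b c
  triple∈T⁻ {a} {b} {c} (distinct a≢b b≢c a≢c) abc∈T with u , v , eq ← ∈T⁻ abc∈T =
    collinear rainbow (subst₂ (λ x y → ZeroSum x y (value c)) (sym (∈-block⁻ a∈)) (sym (∈-block⁻ b∈))
      (trans (coordinates-zeroSum rainbow) (sym (∈-block⁻ c∈))))
    where
    a∈ : a ∈ block u v
    a∈ = subst (a ∈_) eq fst∈
    b∈ : b ∈ block u v
    b∈ = subst (b ∈_) eq (snd∈ {a = a})
    c∈ : c ∈ block u v
    c∈ = subst (c ∈_) eq (thd∈ {a = a} {b})
    rainbow : Distinct (colour a) (colour b) (colour c)
    rainbow = distinct (block-colours-differ a∈ b∈ a≢b) (block-colours-differ b∈ c∈ b≢c)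
                       (block-colours-differ a∈ c∈ a≢c)
    coordinates-zeroSum : ∀ {i j l} → Distinct i j l →
      ZeroSum (coordinate u v i) (coordinate u v j) (coordinate u v l)
    coordinates-zeroSum = Fin3-distinct-elim
      (λ i j l → ZeroSum (coordinate u v i) (coordinate u v j) (coordinate u v l))
      zeroSum-swap₁₂ zeroSum-swap₂₃ refl

  T-uniform : Uniform 3 T
  T-uniform e∈T with u , v , refl ← ∈T⁻ e∈T =
    ∣triple∣ (distinct (vertex≢ {# 0} {# 1} λ ()) (vertex≢ {# 1} {# 2} λ ()) (vertex≢ {# 0} {# 2} λ ()))
    where
    vertex≢ : ∀ {i j u v} → i ≢ j → vertex i u ≢ vertex j v
    vertex≢ {i} {j} {u} {v} i≢j eq =
      i≢j (trans (sym (colour-vertex i u)) (trans (cong colour eq) (colour-vertex j v)))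

  T-linear : Linear T
  T-linear {e} {f} e∈T f∈T = ∣∩∣≤1 e f same
    where
    same : ∀ {a b} → a ≢ b → a ∈ e → b ∈ e → a ∈ f → b ∈ f → e ≡ f
    same {a} {b} a≢b a∈e b∈e a∈f b∈f
      with u , v , refl ← ∈T⁻ e∈T | u′ , v′ , refl ← ∈T⁻ f∈T =
      coordinates-determine-block (colour a) (colour b) (block-colours-differ a∈e b∈e a≢b)
        (trans (sym (∈-block⁻ a∈e)) (∈-block⁻ a∈f)) (trans (sym (∈-block⁻ b∈e)) (∈-block⁻ b∈f))

  -- The transversal design contains neither forbidden hypergraph

  module _ {G : Hypergraph m} {φ : Fin m → V} (φ-inj : Injective _≡_ _≡_ φ)
           (iso : ∀ e → (e List.∈ edges G) ⇔ (image φ e List.∈ edges T)) where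

    image-collinear : ∀ {i j l} → i ≢ j → j ≢ l → i ≢ l → triple i j l List.∈ edges G →
                      Collinear (φ i) (φ j) (φ l)
    image-collinear {i} {j} {l} i≢j j≢l i≢l ijl∈G =
      triple∈T⁻ (distinct (i≢j ∘ φ-inj) (j≢l ∘ φ-inj) (i≢l ∘ φ-inj))
        (subst (List._∈ edges T) (image-triple φ i j l) (Equivalence.to (iso _) ijl∈G))

    collinear-edge : ∀ {i j l} → Collinear (φ i) (φ j) (φ l) → triple i j l List.∈ edges G
    collinear-edge {i} {j} {l} col = Equivalence.from (iso _)
      (subst (List._∈ edges T) (sym (image-triple φ i j l)) (triple∈T⁺ col))

    -- Among more than three vertices two share one of the three colours, but an edge through both
    -- would have to be rainbow.
    not-all-pairs-covered : 3 < m →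
      ¬ (∀ i j → i ≢ j → ∃[ l ] (j ≢ l × i ≢ l × triple i j l List.∈ edges G))
    not-all-pairs-covered 3<m covered =
      let i , j , i<j , c≡       = Fin.pigeonhole 3<m (colour ∘ φ)
          l , j≢l , i≢l , ijl∈G = covered i j (Fin.<⇒≢ i<j)
      in Distinct.a≢b (Collinear.rainbow (image-collinear (Fin.<⇒≢ i<j) j≢l i≢l ijl∈G)) c≡

  -- The middle vertices of any triangle in `T` are collinear, so an induced copy would force the
  -- missing triple {1, 3, 5} into `W³`.
  T-W³-free : ¬ InducedCopy W³ T
  T-W³-free copy with φ , φ-inj , iso ← inducedCopy⁻ copy = 135∉W³ (collinear-edge {G = W³} φ-inj iso
      (closes (image-collinear {G = W³} φ-inj iso {# 0} {# 1} {# 2} (λ ()) (λ ()) (λ ()) (here refl))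
              (image-collinear {G = W³} φ-inj iso {# 2} {# 3} {# 4} (λ ()) (λ ()) (λ ()) (there (here refl)))
              (image-collinear {G = W³} φ-inj iso {# 4} {# 5} {# 0} (λ ()) (λ ()) (λ ()) (there (there (here refl))))))
    where
    closes : ∀ {p q r x y z} → Collinear p x q → Collinear q y r → Collinear r z p → Collinear x y z
    closes {p} {q} {r} {x} {y} {z}
      (collinear (distinct p≢x x≢q p≢q) pxq)
      (collinear (distinct q≢y y≢r q≢r) qyr)
      (collinear (distinct r≢z z≢p r≢p) rzp) =
      collinear
        (distinct (subst₂ _≢_ (sym x≡r) (sym y≡p) r≢p) (subst₂ _≢_ (sym y≡p) (sym z≡q) p≢q)
                  (subst₂ _≢_ (sym x≡r) (sym z≡q) (q≢r ∘ sym)))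
        (zeroSum-closes {p = value p} {q = value q} {r = value r}
          (zeroSum-swap₂₃ pxq) (zeroSum-swap₂₃ qyr) (zeroSum-swap₂₃ rzp))
      where
      -- The corners are pairwise joined by sides and so have all three colours. A middle vertex
      -- differs in colour from both ends of its side, which leaves the colour of the opposite
      -- corner.
      x≡r : colour x ≡ colour r
      x≡r = Fin3-third _ _ _ _ r≢p p≢q (q≢r ∘ sym) (p≢x ∘ sym) x≢q
      y≡p : colour y ≡ colour p
      y≡p = Fin3-third _ _ _ _ p≢q q≢r (r≢p ∘ sym) (q≢y ∘ sym) y≢r
      z≡q : colour z ≡ colour q
      z≡q = Fin3-third _ _ _ _ q≢r r≢p (p≢q ∘ sym) (r≢z ∘ sym) z≢p

  T-F₇-free : ¬ InducedCopy F₇ T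
  T-F₇-free copy = let φ , φ-inj , iso = inducedCopy⁻ copy in
    not-all-pairs-covered {G = F₇} φ-inj iso (s≤s (s≤s (s≤s (s≤s z≤n)))) F₇-line-through

  T-admissible : Admissible 𝒲³,F₇ T
  T-admissible = T-uniform , T-linear , T-W³-free ∷ T-F₇-free ∷ []

  9*#edges-T : 9 * #edges T ≡ (3 * 2 ^ k) ^ 2
  9*#edges-T = trans (cong (9 *_) #edges-T) (square (2 ^ k))
    where
    square : ∀ q → 9 * (q * q) ≡ 3 * q * (3 * q * 1)
    square = solve-∀

-- The bound and its sharpness

n<2^n : ∀ n → n < 2 ^ n
n<2^n zero    = z<s
n<2^n (suc n) = begin-strict
  suc n             ≡⟨ +-comm 1 n ⟩
  n + 1             <⟨ +-mono-<-≤ (n<2^n n) (m^n>0 2 n) ⟩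
  2 ^ n + 2 ^ n     ≡⟨ cong (2 ^ n +_) (+-identityʳ (2 ^ n)) ⟨
  2 ^ suc n         ∎
  where open ≤-Reasoning

upper-bound : ∀ (n : ℕ) (H : Hypergraph n) → Uniform 3 H → Linear H →
              InducedFree 𝒲³,F₇ H → 9 * #edges H ≤ n ^ 2
upper-bound n H uniform linear free = Linear3Graph.9*#edges≤n² H uniform linear free

theorem15 : (∀ (n : ℕ) (H : Hypergraph n) → Uniform 3 H → Linear H →
    InducedFree 𝒲³,F₇ H → 9 * #edges H ≤ n ^ 2)
    × (∀ (n k : ℕ) → ExLinInd≡ n 𝒲³,F₇ k → 9 * k ≤ n ^ 2)
    × (∀ (N : ℕ) → ∃[ n ] (N < n × (∃[ k ] (ExLinInd≡ n 𝒲³,F₇ k × 9 * k ≡ n ^ 2))))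
theorem15 = upper-bound , extremal , sharp
  where
  extremal : ∀ (n k : ℕ) → ExLinInd≡ n 𝒲³,F₇ k → 9 * k ≤ n ^ 2
  extremal n _ ((H , (uniform , linear , free) , refl) , _) = upper-bound n H uniform linear free

  sharp : ∀ (N : ℕ) → ∃[ n ] (N < n × (∃[ k ] (ExLinInd≡ n 𝒲³,F₇ k × 9 * k ≡ n ^ 2)))
  -- The exponent `N` itself is large enough, because `2 ^ N` already exceeds `N`. The design is a
  -- maximum since its edge count meets the upper bound exactly, which is compared after cancelling
  -- the factor 9.
  sharp N = 3 * 2 ^ N
    , <-≤-trans (n<2^n N) (m≤n*m (2 ^ N) 3)
    , #edges T
    , ((T , T-admissible , refl)
      , λ { H (uniform , linear , free) → *-cancelˡ-≤ 9
              (≤-trans (upper-bound _ H uniform linear free) (≤-reflexive (sym 9*#edges-T))) })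
    , 9*#edges-T
    where open Transversal N
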